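{- $\pi(K_{n,n}\square K_{n,n})\le\left(\frac{3}{2}+o(1)\right)n^2$ as $n\to\infty$; that is, $\limsup_{n\to\infty}\pi(K_{n,n}\square K_{n,n})/n^2\le \frac32$.
   Context: $K_{n,n}$ is the complete bipartite graph with both parts of size $n$. For graphs $G,H$, the Cartesian product $G\square H$ has vertex set $V(G)\times V(H)$, with $(g,h)\sim(g',h')$ iff ($g=g'$ and $hh'\in E(H)$) or ($h=h'$ and $gg'\in E(G)$). A vertex coloring $c$ of a graph is non-repetitive if there is no path $v_1,\dots,v_{2k}$ ($k\ge1$, distinct vertices, consecutive ones adjacent) with $c(v_i)=c(v_{k+i})$ for all $1\le i\le k$; $\pi(G)$ denotes the minimum number of colors in a non-repetitive coloring of $G$. -}

module Defs where

open import Level using (Level; suc; _⊔_)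
open import Data.Nat using (ℕ; _+_; _*_; _≤_; _^_)
open import Data.Fin using (Fin; toℕ; _↑ˡ_; _↑ʳ_)
open import Data.Product using (_×_; Σ; ∃; ∃-syntax; _,_)
open import Data.Sum using (_⊎_)
open import Relation.Binary.PropositionalEquality using (_≡_; _≢_)
open import Relation.Nullary using (¬_)
open import Function.Definitions using (Injective)

record Graph : Set₁ where
  field
    V   : Set
    Adj : V → V → Set
open Graph public

K : ℕ → Graph
K n = record { V = Fin 2 × Fin n ; Adj = λ { (s , _) (t , _) → s ≢ t } }

_□_ : Graph → Graph → Graph
G □ H = record
  { V   = V G × V H
  ; Adj = λ { (g , h) (g' , h') → (g ≡ g' × Adj H h h') ⊎ (h ≡ h' × Adj G g g') }
  }

IsPath : (G : Graph) {m : ℕ} → (Fin m → V G) → Set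
IsPath G {m} p =
  Injective _≡_ _≡_ p ×
  (∀ (i j : Fin m) → toℕ j ≡ Data.Nat.suc (toℕ i) → Adj G (p i) (p j))

Repetitive : (G : Graph) {C : Set} (c : V G → C) (k : ℕ) → (Fin (k + k) → V G) → Set
Repetitive G c k p = ∀ (i : Fin k) → c (p (i ↑ˡ k)) ≡ c (p (k ↑ʳ i))

NonRepetitive : (G : Graph) {C : Set} → (V G → C) → Set
NonRepetitive G c =
  ∀ (k : ℕ) → 1 ≤ k → (p : Fin (k + k) → V G) → IsPath G p → ¬ Repetitive G c k p

π≤ : Graph → ℕ → Set
π≤ G m = Σ (V G → Fin m) λ c → NonRepetitive G c

-- Colour the parity classes 00 and 11 of the four n × n blocks with one common
-- colour, give every vertex of block 10 its own colour, and use each colour of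
-- block 01 about twice, pairing its cells by a linear involution of (ℤ/N)²
-- with n ≤ N = n + O(1). In a repetitively coloured path every other vertex is
-- in block 01, and cells two steps apart are collinear, i.e. share a row or
-- a column. But the involution never maps a cell to a different collinear one,
-- nor two distinct collinear cells to collinear ones, so no such path exists.
-- The number of colours is 1 + n² + n²/2 + O(n).

module Submission where

open import Defs
open import Data.Nat using (ℕ; suc; _+_; _*_; _≤_)
open import Data.Product using (Σ; ∃-syntax; _×_)
open import Data.Nat using (zero; _∸_; _⊓_; _<_; z≤n; s≤s; NonZero)
open import Data.Nat.Properties
open import Data.Nat.DivMod using (_/_; _%_; m≡m%n+[m/n]*n; m%n<n; m%n≤n; m/n*n≤m)
open import Data.Nat.Divisibility using (>⇒∤)
import Data.Nat.Tactic.RingSolver as ℕ-Solver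
open import Data.Integer.Base using (ℤ; +_; ∣_∣)
import Data.Integer.Base as ℤ
import Data.Integer.Properties as ℤ
open import Data.Integer.Divisibility.Signed
  using (_∣_; divides; ∣⇒∣ᵤ; ∣m∣n⇒∣m+n; ∣m∣n⇒∣m-n; ∣n⇒∣m*n)
import Data.Integer.Tactic.RingSolver as ℤ-Solver
open import Data.Fin using (Fin; zero; suc; toℕ; fromℕ<; _↑ʳ_)
open import Data.Fin.Properties
  using (toℕ<n; toℕ-injective; fromℕ<-injective; toℕ-↑ʳ; +↔⊎; *↔×; 1↔⊤)
open import Data.Product using (_,_; proj₁; proj₂)
open import Data.Sum using (_⊎_; inj₁; inj₂)
open import Data.Sum.Function.Propositional using (_⊎-↔_)
open import Data.Sum.Properties using (inj₂-injective)
open import Data.Unit using (⊤; tt)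
open import Function using (_∘_; _↔_; _↣_; Injection)
open import Function.Definitions using (Injective)
open import Function.Properties.Inverse using (↔-sym; ↔-trans; ↔⇒↣)
open import Relation.Nullary using (¬_; Dec; yes; no; contradiction)
open import Relation.Binary.PropositionalEquality

-- `IsPath` compares indices through `toℕ`. For an open `k`, `refl` does not show that two indices
-- of the second half are consecutive; this lemma supplies those steps.
↑ʳ-suc : ∀ {m} k {i j : Fin m} → toℕ j ≡ suc (toℕ i) → toℕ (k ↑ʳ j) ≡ suc (toℕ (k ↑ʳ i))
↑ʳ-suc k {i} {j} eq = begin
  toℕ (k ↑ʳ j)         ≡⟨ toℕ-↑ʳ k j ⟩
  k + toℕ j            ≡⟨ cong (λ l → k + l) eq ⟩
  k + suc (toℕ i)      ≡⟨ +-suc k (toℕ i) ⟩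
  suc (k + toℕ i)      ≡⟨ cong suc (toℕ-↑ʳ k i) ⟨
  suc (toℕ (k ↑ʳ i))   ∎
  where open ≡-Reasoning

-- Cells, residues up to sign, and congruences modulo `N`.

Cell : ℕ → Set
Cell n = Fin n × Fin n

Collinear : ∀ {n} → Cell n → Cell n → Set
Collinear (i , j) (k , l) = i ≡ k ⊎ j ≡ l

-- A canonical representative of the residue `r` up to sign modulo `N`.
fold : ℕ → ℕ → ℕ
fold N r = r ⊓ (N ∸ r)

fold-≡ : ∀ {N r s} → r ≤ N → s ≤ N → fold N r ≡ fold N s → r ≡ s ⊎ r + s ≡ N
fold-≡ {N} {r} {s} r≤N s≤N eq with ⊓-sel r (N ∸ r) | ⊓-sel s (N ∸ s)
... | inj₁ p | inj₁ p′ = inj₁ (trans (sym p) (trans eq p′))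
... | inj₁ p | inj₂ p′ rewrite trans (sym p) (trans eq p′) = inj₂ (m∸n+n≡m s≤N)
... | inj₂ p | inj₁ p′ rewrite sym (trans (sym p) (trans eq p′)) = inj₂ (m+[n∸m]≡n r≤N)
... | inj₂ p | inj₂ p′ = inj₁ (∸-cancelˡ-≡ r≤N s≤N (trans (sym p) (trans eq p′)))

-- The modulus is odd, so the smaller of `r` and its negative is at most `6 * q`. Only about half of
-- the residues remain, which is where the term n²/2 in the colour count comes from.
fold-< : ∀ q r → fold (suc (12 * q)) r < suc (6 * q)
fold-< q r with ≤-<-connex r (6 * q)
... | inj₁ r≤6q = s≤s (≤-trans (m⊓n≤m r _) r≤6q)
... | inj₂ 6q<r = s≤s (begin
  fold (suc (12 * q)) r         ≤⟨ m⊓n≤n r _ ⟩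
  suc (12 * q) ∸ r              ≤⟨ ∸-monoʳ-≤ (suc (12 * q)) 6q<r ⟩
  12 * q ∸ 6 * q                ≡⟨ *-distribʳ-∸ q 12 6 ⟨
  6 * q                         ∎)
  where open ≤-Reasoning

+≡+%+/* : ∀ c N .{{_ : NonZero N}} → + c ≡ + (c % N) ℤ.+ + (c / N) ℤ.* + N
+≡+%+/* c N = begin
  + c                                ≡⟨ cong +_ (m≡m%n+[m/n]*n c N) ⟩
  + (c % N) ℤ.+ + (c / N * N)        ≡⟨ cong (ℤ._+_ (+ (c % N))) (ℤ.pos-* (c / N) N) ⟩
  + (c % N) ℤ.+ + (c / N) ℤ.* + N    ∎
  where open ≡-Reasoning

%-≡⇒∣ : ∀ N .{{_ : NonZero N}} a b → a % N ≡ b % N → + N ∣ + a ℤ.- + b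
%-≡⇒∣ N a b eq = divides (+ (a / N) ℤ.- + (b / N)) (begin
  + a ℤ.- + b
    ≡⟨ cong₂ ℤ._-_ (+≡+%+/* a N) (+≡+%+/* b N) ⟩
  (+ (a % N) ℤ.+ + (a / N) ℤ.* + N) ℤ.- (+ (b % N) ℤ.+ + (b / N) ℤ.* + N)
    ≡⟨ cong (λ r → (+ r ℤ.+ + (a / N) ℤ.* + N) ℤ.- (+ (b % N) ℤ.+ + (b / N) ℤ.* + N)) eq ⟩
  (+ (b % N) ℤ.+ + (a / N) ℤ.* + N) ℤ.- (+ (b % N) ℤ.+ + (b / N) ℤ.* + N)
    ≡⟨ ring (+ (b % N)) (+ (a / N)) (+ (b / N)) (+ N) ⟩
  (+ (a / N) ℤ.- + (b / N)) ℤ.* + N ∎)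
  where
  open ≡-Reasoning
  ring : ∀ r x y m → (r ℤ.+ x ℤ.* m) ℤ.- (r ℤ.+ y ℤ.* m) ≡ (x ℤ.- y) ℤ.* m
  ring = ℤ-Solver.solve-∀

%-sum⇒∣ : ∀ N .{{_ : NonZero N}} a b → a % N + b % N ≡ N → + N ∣ + a ℤ.+ + b
%-sum⇒∣ N a b eq = divides (+ 1 ℤ.+ (+ (a / N) ℤ.+ + (b / N))) (begin
  + a ℤ.+ + b
    ≡⟨ cong₂ ℤ._+_ (+≡+%+/* a N) (+≡+%+/* b N) ⟩
  (+ (a % N) ℤ.+ + (a / N) ℤ.* + N) ℤ.+ (+ (b % N) ℤ.+ + (b / N) ℤ.* + N)
    ≡⟨ ring₁ (+ (a % N)) (+ (b % N)) (+ (a / N)) (+ (b / N)) (+ N) ⟩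
  (+ (a % N) ℤ.+ + (b % N)) ℤ.+ (+ (a / N) ℤ.+ + (b / N)) ℤ.* + N
    ≡⟨ cong (λ r → + r ℤ.+ (+ (a / N) ℤ.+ + (b / N)) ℤ.* + N) eq ⟩
  + N ℤ.+ (+ (a / N) ℤ.+ + (b / N)) ℤ.* + N
    ≡⟨ ring₂ (+ N) (+ (a / N) ℤ.+ + (b / N)) ⟩
  (+ 1 ℤ.+ (+ (a / N) ℤ.+ + (b / N))) ℤ.* + N ∎)
  where
  open ≡-Reasoning
  ring₁ : ∀ r s x y m → (r ℤ.+ x ℤ.* m) ℤ.+ (s ℤ.+ y ℤ.* m) ≡ (r ℤ.+ s) ℤ.+ (x ℤ.+ y) ℤ.* m
  ring₁ = ℤ-Solver.solve-∀
  ring₂ : ∀ m x → m ℤ.+ x ℤ.* m ≡ (+ 1 ℤ.+ x) ℤ.* m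
  ring₂ = ℤ-Solver.solve-∀

∣∧<⇒≡0 : ∀ {N} {z : ℤ} → + N ∣ z → ∣ z ∣ < N → z ≡ + 0
∣∧<⇒≡0 {N} {z} N∣z ∣z∣<N with ∣ z ∣ in eq | ∣⇒∣ᵤ N∣z
... | zero  | _   = ℤ.∣i∣≡0⇒i≡0 eq
... | suc _ | N∣∣z∣ = contradiction N∣∣z∣ (>⇒∤ ∣z∣<N)

-- The pairing of cells by an involution of (ℤ/N)².

-- The modulus N = 12 q + 1 is chosen so that 12 is invertible modulo N.
module Grid (q n : ℕ) (n≤N : n ≤ suc (12 * q)) where

  N : ℕ
  N = suc (12 * q)

  -- The inverse of 12 modulo `N` is `- q`, since 12 q = N - 1.
  cancel-12 : ∀ z → + N ∣ + 12 ℤ.* z → + N ∣ z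
  cancel-12 z N∣12z = subst (+ N ∣_) eq
    (∣m∣n⇒∣m-n (divides z refl) (∣n⇒∣m*n (+ q) N∣12z))
    where
    ring : ∀ z Q → z ℤ.* (+ 1 ℤ.+ + 12 ℤ.* Q) ℤ.- Q ℤ.* (+ 12 ℤ.* z) ≡ z
    ring = ℤ-Solver.solve-∀
    eq : z ℤ.* + N ℤ.- + q ℤ.* (+ 12 ℤ.* z) ≡ z
    eq = trans (cong (λ m → z ℤ.* m ℤ.- + q ℤ.* (+ 12 ℤ.* z)) (cong (ℤ._+_ (+ 1)) (ℤ.pos-* 12 q)))
               (ring z (+ q))

  ⟦_⟧ : Fin n → ℤ
  ⟦ i ⟧ = + toℕ i

  -- Coordinates lie below `n ≤ N`, so congruent ones are equal. The factor 12 is a common multiple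
  -- of all the coefficients that the eliminations below produce.
  coordinate-≡ : ∀ i k → + N ∣ + 12 ℤ.* (⟦ i ⟧ ℤ.- ⟦ k ⟧) → i ≡ k
  coordinate-≡ i k N∣ = toℕ-injective (ℤ.+-injective (ℤ.i-j≡0⇒i≡j ⟦ i ⟧ ⟦ k ⟧
    (∣∧<⇒≡0 (cancel-12 _ N∣) (begin-strict
      ∣ ⟦ i ⟧ ℤ.- ⟦ k ⟧ ∣      ≡⟨ cong ∣_∣ (ℤ.m-n≡m⊖n (toℕ i) (toℕ k)) ⟩
      ∣ toℕ i ℤ.⊖ toℕ k ∣      ≤⟨ ℤ.∣m⊝n∣≤m⊔n (toℕ i) (toℕ k) ⟩
      toℕ i Data.Nat.⊔ toℕ k   <⟨ ⊔-pres-<m (toℕ<n i) (toℕ<n k) ⟩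
      n                        ≤⟨ n≤N ⟩
      N                        ∎))))
    where open ≤-Reasoning

  Hue : Set
  Hue = Fin N × Fin (suc (6 * q))

  sum₁ sum₃ : Cell n → ℕ
  sum₁ (x , y) = toℕ x + toℕ y
  sum₃ (x , y) = toℕ x + 3 * toℕ y

  -- In the coordinates s = x + y and t = x + 3 y on (ℤ/N)², two cells share
  -- a hue iff they agree up to the involution (s , t) ↦ (s , - t).
  hue : Cell n → Hue
  hue u = fromℕ< (m%n<n (sum₁ u) N) , fromℕ< (fold-< q (sum₃ u % N))

  infixl 6 _⊕_
  _⊕_ : ∀ {a b} → + N ∣ a → + N ∣ b → + N ∣ a ℤ.+ b
  _⊕_ = ∣m∣n⇒∣m+n

  infixr 7 _⊛_
  _⊛_ : ∀ c {a} → + N ∣ a → + N ∣ c ℤ.* a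
  _⊛_ = ∣n⇒∣m*n

  -- The involution written as two congruences, s ≡ s′ and t ≡ - t′. Solved for the coordinates, it
  -- is (x , y) ↦ (2 x + 3 y , - x - 2 y).
  Twins : Cell n → Cell n → Set
  Twins (x , y) (x′ , y′) =
      (+ N ∣ (⟦ x ⟧ ℤ.+ ⟦ y ⟧) ℤ.- (⟦ x′ ⟧ ℤ.+ ⟦ y′ ⟧))
    × (+ N ∣ (⟦ x ⟧ ℤ.+ + 3 ℤ.* ⟦ y ⟧) ℤ.+ (⟦ x′ ⟧ ℤ.+ + 3 ℤ.* ⟦ y′ ⟧))

  cast-sum₃ : ∀ u → + sum₃ u ≡ ⟦ proj₁ u ⟧ ℤ.+ + 3 ℤ.* ⟦ proj₂ u ⟧
  cast-sum₃ (x , y) = cong (ℤ._+_ ⟦ x ⟧) (ℤ.pos-* 3 (toℕ y))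

  -- The change of coordinates has determinant 2: 2 x = 3 s - t and 2 y = t - s. Both identities are
  -- scaled by 6 to reach the factor 12.
  equal-st⇒≡ : ∀ x y x′ y′ →
    + N ∣ (⟦ x ⟧ ℤ.+ ⟦ y ⟧) ℤ.- (⟦ x′ ⟧ ℤ.+ ⟦ y′ ⟧) →
    + N ∣ (⟦ x ⟧ ℤ.+ + 3 ℤ.* ⟦ y ⟧) ℤ.- (⟦ x′ ⟧ ℤ.+ + 3 ℤ.* ⟦ y′ ⟧) →
    (x , y) ≡ (x′ , y′)
  equal-st⇒≡ x y x′ y′ S T = cong₂ _,_
    (coordinate-≡ x x′ (subst (+ N ∣_) (ring₁ ⟦ x ⟧ ⟦ y ⟧ ⟦ x′ ⟧ ⟦ y′ ⟧) (+ 18 ⊛ S ⊕ ℤ.- (+ 6) ⊛ T)))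
    (coordinate-≡ y y′ (subst (+ N ∣_) (ring₂ ⟦ x ⟧ ⟦ y ⟧ ⟦ x′ ⟧ ⟦ y′ ⟧) (ℤ.- (+ 6) ⊛ S ⊕ + 6 ⊛ T)))
    where
    ring₁ : ∀ x y x′ y′ →
      + 18 ℤ.* ((x ℤ.+ y) ℤ.- (x′ ℤ.+ y′)) ℤ.+
      ℤ.- (+ 6) ℤ.* ((x ℤ.+ + 3 ℤ.* y) ℤ.- (x′ ℤ.+ + 3 ℤ.* y′)) ≡ + 12 ℤ.* (x ℤ.- x′)
    ring₁ = ℤ-Solver.solve-∀
    ring₂ : ∀ x y x′ y′ →
      ℤ.- (+ 6) ℤ.* ((x ℤ.+ y) ℤ.- (x′ ℤ.+ y′)) ℤ.+
      + 6 ℤ.* ((x ℤ.+ + 3 ℤ.* y) ℤ.- (x′ ℤ.+ + 3 ℤ.* y′)) ≡ + 12 ℤ.* (y ℤ.- y′)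
    ring₂ = ℤ-Solver.solve-∀

  -- Equal folded residues leave t ≡ t′ or t ≡ - t′. The first, together with s ≡ s′, would make the
  -- cells equal.
  hue-≡⇒Twins : ∀ u v → u ≢ v → hue u ≡ hue v → Twins u v
  hue-≡⇒Twins u v u≢v eq with fold-≡ (m%n≤n (sum₃ u) N) (m%n≤n (sum₃ v) N)
                                (fromℕ<-injective _ _ _ _ (cong proj₂ eq))
  ... | inj₁ same = contradiction
    (equal-st⇒≡ _ _ _ _
      (%-≡⇒∣ N (sum₁ u) (sum₁ v) (fromℕ<-injective _ _ _ _ (cong proj₁ eq)))
      (subst₂ (λ a b → + N ∣ a ℤ.- b) (cast-sum₃ u) (cast-sum₃ v)
        (%-≡⇒∣ N (sum₃ u) (sum₃ v) same)))
    u≢v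
  ... | inj₂ opposite =
      %-≡⇒∣ N (sum₁ u) (sum₁ v) (fromℕ<-injective _ _ _ _ (cong proj₁ eq))
    , subst₂ (λ a b → + N ∣ a ℤ.+ b) (cast-sum₃ u) (cast-sum₃ v)
        (%-sum⇒∣ N (sum₃ u) (sum₃ v) opposite)

  -- Within a single row or column, s = x + y already determines the cell.
  Twins-¬collinear : ∀ {u v} → u ≢ v → Twins u v → ¬ Collinear u v
  Twins-¬collinear {x , y} {_ , y′} u≢v (S , _) (inj₁ refl) = u≢v (cong (x ,_)
    (coordinate-≡ y y′ (subst (+ N ∣_) (ring ⟦ x ⟧ ⟦ y ⟧ ⟦ y′ ⟧) (+ 12 ⊛ S))))
    where
    ring : ∀ x y y′ → + 12 ℤ.* ((x ℤ.+ y) ℤ.- (x ℤ.+ y′)) ≡ + 12 ℤ.* (y ℤ.- y′)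
    ring = ℤ-Solver.solve-∀
  Twins-¬collinear {x , y} {x′ , _} u≢v (S , _) (inj₂ refl) = u≢v (cong (_, y)
    (coordinate-≡ x x′ (subst (+ N ∣_) (ring ⟦ x ⟧ ⟦ y ⟧ ⟦ x′ ⟧) (+ 12 ⊛ S))))
    where
    ring : ∀ x y x′ → + 12 ℤ.* ((x ℤ.+ y) ℤ.- (x′ ℤ.+ y)) ≡ + 12 ℤ.* (x ℤ.- x′)
    ring = ℤ-Solver.solve-∀

  -- The involution sends horizontal and vertical directions to oblique ones.
  Twins-break-lines : ∀ {u v u′ v′} → u ≢ v → Twins u u′ → Twins v v′ →
    Collinear u v → ¬ Collinear u′ v′
  Twins-break-lines {x , y} {_ , z} {x′ , y′} {_ , z′} u≢v (S , T) (S′ , T′) (inj₁ refl) (inj₁ refl) =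
    u≢v (cong (x ,_) (coordinate-≡ y z (subst (+ N ∣_)
      (ring ⟦ x ⟧ ⟦ y ⟧ ⟦ z ⟧ ⟦ x′ ⟧ ⟦ y′ ⟧ ⟦ z′ ⟧)
      -- In each of the four cases the coefficients cancel all primed coordinates and leave 12 times
      -- the difference in the one coordinate where `u` and `v` may differ.
      ((+ 6 ⊛ S ⊕ + 2 ⊛ T) ⊕ (ℤ.- (+ 6) ⊛ S′ ⊕ ℤ.- (+ 2) ⊛ T′)))))
    where
    ring : ∀ x y z x′ y′ z′ →
      (+ 6 ℤ.* ((x ℤ.+ y) ℤ.- (x′ ℤ.+ y′)) ℤ.+
       + 2 ℤ.* ((x ℤ.+ + 3 ℤ.* y) ℤ.+ (x′ ℤ.+ + 3 ℤ.* y′))) ℤ.+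
      (ℤ.- (+ 6) ℤ.* ((x ℤ.+ z) ℤ.- (x′ ℤ.+ z′)) ℤ.+
       ℤ.- (+ 2) ℤ.* ((x ℤ.+ + 3 ℤ.* z) ℤ.+ (x′ ℤ.+ + 3 ℤ.* z′))) ≡ + 12 ℤ.* (y ℤ.- z)
    ring = ℤ-Solver.solve-∀
  Twins-break-lines {x , y} {_ , z} {x′ , y′} {z′ , _} u≢v (S , T) (S′ , T′) (inj₁ refl) (inj₂ refl) =
    u≢v (cong (x ,_) (coordinate-≡ y z (subst (+ N ∣_)
      (ring ⟦ x ⟧ ⟦ y ⟧ ⟦ z ⟧ ⟦ x′ ⟧ ⟦ y′ ⟧ ⟦ z′ ⟧)
      ((+ 3 ⊛ S ⊕ + 3 ⊛ T) ⊕ (ℤ.- (+ 3) ⊛ S′ ⊕ ℤ.- (+ 3) ⊛ T′)))))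
    where
    ring : ∀ x y z x′ y′ z′ →
      (+ 3 ℤ.* ((x ℤ.+ y) ℤ.- (x′ ℤ.+ y′)) ℤ.+
       + 3 ℤ.* ((x ℤ.+ + 3 ℤ.* y) ℤ.+ (x′ ℤ.+ + 3 ℤ.* y′))) ℤ.+
      (ℤ.- (+ 3) ℤ.* ((x ℤ.+ z) ℤ.- (z′ ℤ.+ y′)) ℤ.+
       ℤ.- (+ 3) ℤ.* ((x ℤ.+ + 3 ℤ.* z) ℤ.+ (z′ ℤ.+ + 3 ℤ.* y′))) ≡ + 12 ℤ.* (y ℤ.- z)
    ring = ℤ-Solver.solve-∀
  Twins-break-lines {x , y} {z , _} {x′ , y′} {_ , z′} u≢v (S , T) (S′ , T′) (inj₂ refl) (inj₁ refl) =
    u≢v (cong (_, y) (coordinate-≡ x z (subst (+ N ∣_)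
      (ring ⟦ x ⟧ ⟦ y ⟧ ⟦ z ⟧ ⟦ x′ ⟧ ⟦ y′ ⟧ ⟦ z′ ⟧)
      ((+ 9 ⊛ S ⊕ + 3 ⊛ T) ⊕ (ℤ.- (+ 9) ⊛ S′ ⊕ ℤ.- (+ 3) ⊛ T′)))))
    where
    ring : ∀ x y z x′ y′ z′ →
      (+ 9 ℤ.* ((x ℤ.+ y) ℤ.- (x′ ℤ.+ y′)) ℤ.+
       + 3 ℤ.* ((x ℤ.+ + 3 ℤ.* y) ℤ.+ (x′ ℤ.+ + 3 ℤ.* y′))) ℤ.+
      (ℤ.- (+ 9) ℤ.* ((z ℤ.+ y) ℤ.- (x′ ℤ.+ z′)) ℤ.+
       ℤ.- (+ 3) ℤ.* ((z ℤ.+ + 3 ℤ.* y) ℤ.+ (x′ ℤ.+ + 3 ℤ.* z′))) ≡ + 12 ℤ.* (x ℤ.- z)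
    ring = ℤ-Solver.solve-∀
  Twins-break-lines {x , y} {z , _} {x′ , y′} {z′ , _} u≢v (S , T) (S′ , T′) (inj₂ refl) (inj₂ refl) =
    u≢v (cong (_, y) (coordinate-≡ x z (subst (+ N ∣_)
      (ring ⟦ x ⟧ ⟦ y ⟧ ⟦ z ⟧ ⟦ x′ ⟧ ⟦ y′ ⟧ ⟦ z′ ⟧)
      ((+ 6 ⊛ S ⊕ + 6 ⊛ T) ⊕ (ℤ.- (+ 6) ⊛ S′ ⊕ ℤ.- (+ 6) ⊛ T′)))))
    where
    ring : ∀ x y z x′ y′ z′ →
      (+ 6 ℤ.* ((x ℤ.+ y) ℤ.- (x′ ℤ.+ y′)) ℤ.+
       + 6 ℤ.* ((x ℤ.+ + 3 ℤ.* y) ℤ.+ (x′ ℤ.+ + 3 ℤ.* y′))) ℤ.+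
      (ℤ.- (+ 6) ℤ.* ((z ℤ.+ y) ℤ.- (z′ ℤ.+ y′)) ℤ.+
       ℤ.- (+ 6) ℤ.* ((z ℤ.+ + 3 ℤ.* y) ℤ.+ (z′ ℤ.+ + 3 ℤ.* y′))) ≡ + 12 ℤ.* (x ℤ.- z)
    ring = ℤ-Solver.solve-∀

-- The colouring of the product and its repetition-free paths.

≢∧≢⇒≡ : ∀ {a b c : Fin 2} → b ≢ a → b ≢ c → a ≡ c
≢∧≢⇒≡ {zero}     {zero}     {_}        b≢a _ = contradiction refl b≢a
≢∧≢⇒≡ {zero}     {suc zero} {zero}     _ _   = refl
≢∧≢⇒≡ {zero}     {suc zero} {suc zero} _ b≢c = contradiction refl b≢c
≢∧≢⇒≡ {suc zero} {zero}     {zero}     _ b≢c = contradiction refl b≢c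
≢∧≢⇒≡ {suc zero} {zero}     {suc zero} _ _   = refl
≢∧≢⇒≡ {suc zero} {suc zero} {_}        b≢a _ = contradiction refl b≢a

module Colouring {n : ℕ} {H : Set} (hue : Cell n → H)
  (twins-¬collinear : ∀ {u v} → u ≢ v → hue u ≡ hue v → ¬ Collinear u v)
  (twins-break-lines : ∀ {u v u′ v′} → u ≢ v →
    u ≢ u′ → hue u ≡ hue u′ → v ≢ v′ → hue v ≡ hue v′ →
    Collinear u v → ¬ Collinear u′ v′)
  where

  G : Graph
  G = K n □ K n

  Colour : Set
  Colour = ⊤ ⊎ (Cell n ⊎ H)

  pattern silent    = inj₁ tt
  pattern unique u  = inj₂ (inj₁ u)
  pattern paired h  = inj₂ (inj₂ h)

  colour : V G → Colour
  colour ((zero , _)     , (zero , _))     = silent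
  colour ((suc zero , _) , (suc zero , _)) = silent
  colour ((suc zero , i) , (zero , j))     = unique (i , j)
  colour ((zero , i)     , (suc zero , j)) = paired (hue (i , j))

  Silent : V G → Set
  Silent v = colour v ≡ silent

  silent? : ∀ v → Dec (Silent v)
  silent? ((zero , _)     , (zero , _))     = yes refl
  silent? ((suc zero , _) , (suc zero , _)) = yes refl
  silent? ((suc zero , _) , (zero , _))     = no λ ()
  silent? ((zero , _)     , (suc zero , _)) = no λ ()

  silent⇒sides-≡ : ∀ v → Silent v → proj₁ (proj₁ v) ≡ proj₁ (proj₂ v)
  silent⇒sides-≡ ((zero , _)     , (zero , _))     _ = refl
  silent⇒sides-≡ ((suc zero , _) , (suc zero , _)) _ = refl
  silent⇒sides-≡ ((zero , _)     , (suc zero , _)) ()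
  silent⇒sides-≡ ((suc zero , _) , (zero , _))     ()

  sides-≡⇒silent : ∀ v → proj₁ (proj₁ v) ≡ proj₁ (proj₂ v) → Silent v
  sides-≡⇒silent ((zero , _)     , (zero , _))     _ = refl
  sides-≡⇒silent ((suc zero , _) , (suc zero , _)) _ = refl

  -- An edge changes exactly one of the two sides, hence flips whether they agree. Silent and
  -- audible vertices therefore alternate along a path.
  neighbour-of-silent : ∀ u v → Adj G u v → Silent u → ¬ Silent v
  neighbour-of-silent u v (inj₁ (refl , ≢)) s t =
    ≢ (trans (sym (silent⇒sides-≡ u s)) (silent⇒sides-≡ v t))
  neighbour-of-silent u v (inj₂ (refl , ≢)) s t =
    ≢ (trans (silent⇒sides-≡ u s) (sym (silent⇒sides-≡ v t)))

  neighbour-of-audible : ∀ u v → Adj G u v → ¬ Silent u → Silent v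
  neighbour-of-audible u v (inj₁ (refl , ≢)) ¬s =
    sides-≡⇒silent v (≢∧≢⇒≡ (¬s ∘ sides-≡⇒silent u ∘ sym) ≢)
  neighbour-of-audible u v (inj₂ (refl , ≢)) ¬s =
    sides-≡⇒silent v (sym (≢∧≢⇒≡ (¬s ∘ sides-≡⇒silent u) ≢))

  adjacent⇒colour-≢ : ∀ u v → Adj G u v → colour u ≢ colour v
  adjacent⇒colour-≢ u v u~v eq with silent? u
  ... | yes s = neighbour-of-silent u v u~v s (trans (sym eq) s)
  ... | no ¬s = ¬s (trans eq (neighbour-of-audible u v u~v ¬s))

  two-steps-from-audible : ∀ x y z → Adj G x y → Adj G y z → ¬ Silent x → ¬ Silent z
  two-steps-from-audible x y z x~y y~z ¬s =
    neighbour-of-silent y z y~z (neighbour-of-audible x y x~y ¬s)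

  place : Cell n → V G
  place (i , j) = (zero , i) , (suc zero , j)

  -- A `unique` colour determines its vertex, so an audible colour can repeat only inside the
  -- `paired` block.
  audible-repetition : ∀ {x x′} → ¬ Silent x → x ≢ x′ → colour x ≡ colour x′ →
    ∃[ u ] ∃[ u′ ] x ≡ place u × x′ ≡ place u′ × u ≢ u′ × hue u ≡ hue u′
  audible-repetition {(zero , _)     , (zero , _)}     ¬s _ _ = contradiction refl ¬s
  audible-repetition {(suc zero , _) , (suc zero , _)} ¬s _ _ = contradiction refl ¬s
  audible-repetition {(suc zero , _) , (zero , _)} {(suc zero , _) , (zero , _)} _ x≢x′ refl =
    contradiction refl x≢x′
  audible-repetition {(zero , _) , (suc zero , _)} {(zero , _) , (suc zero , _)} _ x≢x′ eq =
    _ , _ , refl , refl , (λ { refl → x≢x′ refl }) , inj₂-injective (inj₂-injective eq)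
  audible-repetition {(suc zero , _) , (zero , _)} {(zero , _)     , (zero , _)}     _ _ ()
  audible-repetition {(suc zero , _) , (zero , _)} {(zero , _)     , (suc zero , _)} _ _ ()
  audible-repetition {(suc zero , _) , (zero , _)} {(suc zero , _) , (suc zero , _)} _ _ ()
  audible-repetition {(zero , _) , (suc zero , _)} {(zero , _)     , (zero , _)}     _ _ ()
  audible-repetition {(zero , _) , (suc zero , _)} {(suc zero , _) , (zero , _)}     _ _ ()
  audible-repetition {(zero , _) , (suc zero , _)} {(suc zero , _) , (suc zero , _)} _ _ ()

  -- Both ends have the same pair of sides, so both steps move in the same factor and the coordinate
  -- in the other factor stays fixed. Steps in different factors would change both sides.
  two-steps⇒Collinear : ∀ u y v → Adj G (place u) y → Adj G y (place v) → Collinear u v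
  two-steps⇒Collinear _ _ _ (inj₁ (refl , _)) (inj₁ (refl , _)) = inj₁ refl
  two-steps⇒Collinear _ _ _ (inj₂ (refl , _)) (inj₂ (refl , _)) = inj₂ refl
  two-steps⇒Collinear _ _ _ (inj₁ (_ , ≢)) (inj₂ (refl , _)) = contradiction refl ≢
  two-steps⇒Collinear _ _ _ (inj₂ (_ , ≢)) (inj₁ (refl , _)) = contradiction refl ≢

  two-steps⇒colour-≢ : ∀ {x y z} → ¬ Silent x → Adj G x y → Adj G y z → x ≢ z →
    colour x ≢ colour z
  two-steps⇒colour-≢ {y = y} ¬s x~y y~z x≢z eq
    with u , v , refl , refl , u≢v , same ← audible-repetition ¬s x≢z eq
    = twins-¬collinear u≢v same (two-steps⇒Collinear u y v x~y y~z)

  -- The obstruction for long paths: a two-step segment with audible ends and its copy in the other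
  -- half would give two collinear cells whose twins are collinear too.
  no-repeated-corner : ∀ {x y z x′ y′ z′} → ¬ Silent x → x ≢ z →
    Adj G x y → Adj G y z → Adj G x′ y′ → Adj G y′ z′ →
    x ≢ x′ → colour x ≡ colour x′ → z ≢ z′ → colour z ≢ colour z′
  no-repeated-corner {x} {y} {z} {y′ = y′} ¬s x≢z x~y y~z x′~y′ y′~z′ x≢x′ x-eq z≢z′ z-eq
    with u , u′ , refl , refl , u≢u′ , u-eq ← audible-repetition ¬s x≢x′ x-eq
       | v , v′ , refl , refl , v≢v′ , v-eq ←
           audible-repetition (two-steps-from-audible x y z x~y y~z ¬s) z≢z′ z-eq
    = twins-break-lines (x≢z ∘ cong place) u≢u′ u-eq v≢v′ v-eq
        (two-steps⇒Collinear u y v x~y y~z) (two-steps⇒Collinear u′ y′ v′ x′~y′ y′~z′)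

  -- Half-length 1 fails because the colouring is proper. For 2, an audible vertex and its copy are
  -- two steps apart. From 3 on, a segment of three vertices starting at the first audible one is
  -- compared with its copy.
  colour-nonRepetitive : NonRepetitive G colour
  colour-nonRepetitive 1 _ p (_ , adj) rep =
    adjacent⇒colour-≢ (p zero) (p (suc zero)) (adj _ _ refl) (rep zero)
  colour-nonRepetitive 2 _ p (inj , adj) rep with silent? (p zero)
  ... | no ¬s = two-steps⇒colour-≢ ¬s (adj zero (suc zero) refl) (adj _ _ refl)
                  ((λ ()) ∘ inj) (rep zero)
  ... | yes s = two-steps⇒colour-≢ (neighbour-of-silent (p zero) (p (suc zero)) (adj _ _ refl) s)
                  (adj (suc zero) (suc (suc zero)) refl) (adj _ _ refl)
                  ((λ ()) ∘ inj) (rep (suc zero))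
  colour-nonRepetitive k@(suc (suc (suc k-3))) _ p (inj , adj) rep with silent? (p zero)
  ... | no ¬s = no-repeated-corner ¬s ((λ ()) ∘ inj)
                  (adj zero (suc zero) refl) (adj (suc zero) (suc (suc zero)) refl)
                  (adj (k ↑ʳ zero) (k ↑ʳ suc zero) (↑ʳ-suc k refl))
                  (adj (k ↑ʳ suc zero) (k ↑ʳ suc (suc zero)) (↑ʳ-suc k refl))
                  ((λ ()) ∘ inj) (rep zero) ((λ ()) ∘ inj) (rep (suc (suc zero)))
  -- With a silent start the segment would leave the first half. Here parity decides: positions 0
  -- and 3 are an odd distance apart, so exactly one of them is silent.
  colour-nonRepetitive 3 _ p (_ , adj) rep | yes s =
    neighbour-of-silent (p (suc (suc zero))) (p (suc (suc (suc zero)))) (adj _ _ refl)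
      (neighbour-of-audible (p (suc zero)) (p (suc (suc zero))) (adj _ _ refl)
        (neighbour-of-silent (p zero) (p (suc zero)) (adj _ _ refl) s))
      (trans (sym (rep zero)) s)
  -- The first audible position is 1, and half-length at least 4 keeps positions 1 to 3 in the first
  -- half.
  colour-nonRepetitive k@(suc (suc (suc (suc k-4)))) _ p (inj , adj) rep | yes s =
    no-repeated-corner (neighbour-of-silent (p zero) (p (suc zero)) (adj _ _ refl) s)
      ((λ ()) ∘ inj)
      (adj (suc zero) (suc (suc zero)) refl) (adj (suc (suc zero)) (suc (suc (suc zero))) refl)
      (adj (k ↑ʳ suc zero) (k ↑ʳ suc (suc zero)) (↑ʳ-suc k refl))
      (adj (k ↑ʳ suc (suc zero)) (k ↑ʳ suc (suc (suc zero))) (↑ʳ-suc k refl))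
      ((λ ()) ∘ inj) (rep (suc zero)) ((λ ()) ∘ inj) (rep (suc (suc (suc zero))))

-- Counting the colours.

Fin↔Colour : ∀ {a b c d} →
  Fin (1 + (a * b + c * d)) ↔ (⊤ ⊎ ((Fin a × Fin b) ⊎ (Fin c × Fin d)))
Fin↔Colour = ↔-trans +↔⊎ (1↔⊤ ⊎-↔ ↔-trans +↔⊎ (*↔× ⊎-↔ *↔×))

NonRepetitive-∘ : ∀ G {C D} (c : V G → C) {f : C → D} → Injective _≡_ _≡_ f →
  NonRepetitive G c → NonRepetitive G (f ∘ c)
NonRepetitive-∘ G c f-inj nonRep k 1≤k p path rep = nonRep k 1≤k p path (f-inj ∘ rep)

colours : ℕ → ℕ → ℕ
colours q n = 1 + (n * n + suc (12 * q) * suc (6 * q))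

π≤-colours : ∀ q n → n ≤ suc (12 * q) → π≤ (K n □ K n) (colours q n)
π≤-colours q n n≤N = Injection.to encode ∘ colour
  , NonRepetitive-∘ G colour (Injection.injective encode) colour-nonRepetitive
  where
  open Grid q n n≤N
  encode : (⊤ ⊎ (Cell n ⊎ Hue)) ↣ Fin (colours q n)
  encode = ↔⇒↣ (↔-sym Fin↔Colour)
  open Colouring hue
    (λ u≢v eq → Twins-¬collinear u≢v (hue-≡⇒Twins _ _ u≢v eq))
    (λ u≢v u≢u′ u-eq v≢v′ v-eq → Twins-break-lines u≢v
      (hue-≡⇒Twins _ _ u≢u′ u-eq) (hue-≡⇒Twins _ _ v≢v′ v-eq))

-- Twice the colour count is at most 3 n² + 27 n + 184, hence at most 3 n² + 211 n; the threshold
-- `211 * k ≤ n` absorbs the linear term into n².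
colours-bound : ∀ k q n → 12 * q ≤ n + 12 → 211 * k ≤ n → 1 ≤ n →
  2 * k * colours q n ≤ (3 * k + 2) * (n * n)
colours-bound k q n 12q≤ 211k≤n 1≤n = begin
  2 * k * colours q n
    ≡⟨ ring₁ k q n ⟩
  k * (2 + 2 * (n * n) + (1 + 12 * q) * (2 + 12 * q))
    ≤⟨ *-monoʳ-≤ k (+-monoʳ-≤ (2 + 2 * (n * n)) (*-mono-≤ (+-monoʳ-≤ 1 12q≤) (+-monoʳ-≤ 2 12q≤))) ⟩
  k * (2 + 2 * (n * n) + (1 + (n + 12)) * (2 + (n + 12)))
    ≡⟨ ring₂ k n ⟩
  k * (3 * (n * n) + 27 * n + 184 * 1)
    ≤⟨ *-monoʳ-≤ k (+-monoʳ-≤ (3 * (n * n) + 27 * n) (*-monoʳ-≤ 184 1≤n)) ⟩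
  k * (3 * (n * n) + 27 * n + 184 * n)
    ≡⟨ ring₃ k n ⟩
  3 * k * (n * n) + 211 * k * n
    ≤⟨ +-monoʳ-≤ (3 * k * (n * n)) (*-monoˡ-≤ n 211k≤n) ⟩
  3 * k * (n * n) + n * n
    ≤⟨ +-monoʳ-≤ (3 * k * (n * n)) (m≤m+n (n * n) (1 * (n * n))) ⟩
  3 * k * (n * n) + 2 * (n * n)
    ≡⟨ *-distribʳ-+ (n * n) (3 * k) 2 ⟨
  (3 * k + 2) * (n * n) ∎
  where
  open ≤-Reasoning
  ring₁ : ∀ k q n → 2 * k * (1 + (n * n + (1 + 12 * q) * (1 + 6 * q))) ≡
    k * (2 + 2 * (n * n) + (1 + 12 * q) * (2 + 12 * q))
  ring₁ = ℕ-Solver.solve-∀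
  ring₂ : ∀ k n → k * (2 + 2 * (n * n) + (1 + (n + 12)) * (2 + (n + 12))) ≡
    k * (3 * (n * n) + 27 * n + 184 * 1)
  ring₂ = ℕ-Solver.solve-∀
  ring₃ : ∀ k n → k * (3 * (n * n) + 27 * n + 184 * n) ≡ 3 * k * (n * n) + 211 * k * n
  ring₃ = ℕ-Solver.solve-∀

≤-nextMultiple : ∀ n → n ≤ suc (12 * suc (n / 12))
≤-nextMultiple n = begin
  n                         ≡⟨ m≡m%n+[m/n]*n n 12 ⟩
  n % 12 + n / 12 * 12      ≤⟨ +-mono-≤ (m%n≤n n 12) (≤-reflexive (*-comm (n / 12) 12)) ⟩
  12 + 12 * (n / 12)        ≡⟨ *-suc 12 (n / 12) ⟨
  12 * suc (n / 12)         ≤⟨ n≤1+n _ ⟩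
  suc (12 * suc (n / 12))   ∎
  where open ≤-Reasoning

nextMultiple-≤ : ∀ n → 12 * suc (n / 12) ≤ n + 12
nextMultiple-≤ n = begin
  12 * suc (n / 12)     ≡⟨ *-comm 12 (suc (n / 12)) ⟩
  12 + n / 12 * 12      ≤⟨ +-monoʳ-≤ 12 (m/n*n≤m n 12) ⟩
  12 + n                ≡⟨ +-comm 12 n ⟩
  n + 12                ∎
  where open ≤-Reasoning

-- The limsup with denominators cleared: for positive `n` the inequality reads m / n² ≤ 3/2 + 1/(k +
-- 1), and the last term tends to 0.
theorem7 : ∀ (k : ℕ) → ∃[ N ] ∀ (n : ℕ) → N ≤ n →
    ∃[ m ] (2 * suc k * m ≤ (3 * suc k + 2) * (n * n)) × π≤ (K n □ K n) m
-- Taking q = n / 12 + 1 makes `12 * q` the first multiple of 12 above `n`, so the modulus covers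
-- the grid and exceeds `n` by a bounded amount.
theorem7 k = 211 * suc k , λ n 211k≤n → colours (suc (n / 12)) n
  , colours-bound (suc k) (suc (n / 12)) n (nextMultiple-≤ n) 211k≤n (≤-trans (s≤s z≤n) 211k≤n)
  , π≤-colours (suc (n / 12)) n (≤-nextMultiple n)
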